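{- Let $\alpha \ge 1$ be an integer and let $G=(V,E)$ be a finite simple graph of arboricity at most $\alpha$ whose edges are presented as a stream $e_1, e_2, \ldots, e_m$ in an arbitrary order (each edge appearing exactly once). Let $E_\alpha \subseteq E$ be the set of edges $uv$ such that at most $\alpha$ edges incident to $u$ appear in the stream after $uv$, and at most $\alpha$ edges incident to $v$ appear in the stream after $uv$. Then $$\mathrm{match}(G) \le |E_\alpha| \le (\alpha+2)\,\mathrm{match}(G),$$ where $\mathrm{match}(G)$ denotes the maximum size of a matching in $G$.
   Context: A graph has arboricity at most $\alpha$ if its edge set can be partitioned into at most $\alpha$ forests. $\mathrm{match}(G)$ is the maximum number of edges in a matching of $G$. -}

module Defs where

open import Data.Nat using (ℕ; zero; suc; _+_; _*_; _≤_)
open import Data.Fin using (Fin; zero; suc; inject₁; fromℕ; _<_) renaming (_≟_ to _≟ᶠ_)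
open import Data.Fin.Subset using (Subset; _∈_)
open import Data.List using (List; length; filter)
open import Data.List.Base using ()
open import Data.Fin.Base using ()
open import Data.Product using (_×_; _,_; proj₁; proj₂; ∃; Σ)
open import Data.Sum using (_⊎_)
open import Relation.Nullary using (¬_; Dec)
open import Relation.Unary using (Decidable)
open import Relation.Nullary.Decidable using (_⊎-dec_)
open import Relation.Binary.PropositionalEquality using (_≡_; _≢_)
open import Function.Definitions using (Injective)
import Data.List as L

-- Vertices are Fin n.  An edge stream of length m is a function
-- e : Fin m → Fin n × Fin n ; position i of the stream carries edge e i.
Stream : ℕ → ℕ → Set
Stream n m = Fin m → Fin n × Fin n

SameEdge : ∀ {n} → Fin n × Fin n → Fin n × Fin n → Set
SameEdge (a , b) (c , d) = (a ≡ c × b ≡ d) ⊎ (a ≡ d × b ≡ c)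

SimpleStream : ∀ {n m} → Stream n m → Set
SimpleStream {n} {m} e =
  (∀ i → proj₁ (e i) ≢ proj₂ (e i)) ×
  (∀ i j → SameEdge (e i) (e j) → i ≡ j)

Incident : ∀ {n} → Fin n → Fin n × Fin n → Set
Incident u (a , b) = u ≡ a ⊎ u ≡ b

incident? : ∀ {n} (u : Fin n) (x : Fin n × Fin n) → Dec (Incident u x)
incident? u (a , b) = (u ≟ᶠ a) ⊎-dec (u ≟ᶠ b)

count : ∀ {m} {P : Fin m → Set} → Decidable P → ℕ
count {m} P? = length (filter P? (L.allFin m))

laterIncident : ∀ {n m} → Stream n m → Fin m → Fin n → ℕ
laterIncident {n} {m} e i u =
  count {m} {λ j → (i < j) × Incident u (e j)}
    (λ j → (i Data.Fin.<? j) Relation.Nullary.Decidable.×-dec incident? u (e j))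

InEα : ∀ {n m} → ℕ → Stream n m → Fin m → Set
InEα α e i = laterIncident e i (proj₁ (e i)) ≤ α × laterIncident e i (proj₂ (e i)) ≤ α

inEα? : ∀ {n m} (α : ℕ) (e : Stream n m) → Decidable (InEα α e)
inEα? α e i = (laterIncident e i (proj₁ (e i)) Data.Nat.≤? α)
  Relation.Nullary.Decidable.×-dec (laterIncident e i (proj₂ (e i)) Data.Nat.≤? α)

sizeEα : ∀ {n m} → ℕ → Stream n m → ℕ
sizeEα α e = count (inEα? α e)

IsMatching : ∀ {n m} → Stream n m → Subset m → Set
IsMatching e M = ∀ i j → i ∈ M → j ∈ M → i ≢ j →
  ∀ u → Incident u (e i) → ¬ Incident u (e j)

IsMaximumMatching : ∀ {n m} → Stream n m → Subset m → Set
IsMaximumMatching e M =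
  IsMatching e M × (∀ M' → IsMatching e M' → Data.Fin.Subset.∣ M' ∣ ≤ Data.Fin.Subset.∣ M ∣)

AdjIn : ∀ {n m} → Stream n m → (Fin m → Set) → Fin n → Fin n → Set
AdjIn e S u v = ∃ λ i → S i × SameEdge (e i) (u , v)

HasCycle : ∀ {n m} → Stream n m → (Fin m → Set) → Set
HasCycle {n} e S = ∃ λ k → Σ (Fin (3 + k) → Fin n) λ f →
  Injective _≡_ _≡_ f ×
  (∀ (i : Fin (2 + k)) → AdjIn e S (f (inject₁ i)) (f (suc i))) ×
  AdjIn e S (f (fromℕ (2 + k))) (f zero)

IsForest : ∀ {n m} → Stream n m → (Fin m → Set) → Set
IsForest e S = ¬ HasCycle e S

-- Arboricity at most α: the edges can be partitioned into α forests
-- (colour each edge by one of α classes, each class a forest; empty classes allowed).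
ArboricityAtMost : ∀ {n m} → ℕ → Stream n m → Set
ArboricityAtMost {n} {m} α e =
  ∃ λ (col : Fin m → Fin α) → ∀ (c : Fin α) → IsForest e (λ i → col i ≡ c)

{-# OPTIONS --safe #-}
module Submission where

-- Upper bound.  Every vertex has degree at most α + 1 in E_α, so it suffices that a simple graph
-- of maximum degree Δ has at most (Δ + 1) ν edges, ν being its matching number.  If some vertex
-- lies in every maximum matching, delete it and use induction on ν.  Otherwise let M be a
-- maximum matching.  By Gallai's exchange argument no vertex has two neighbours missed by M, so
-- the degrees of the missed vertices add up to at most the number 2 ν of covered vertices,
-- while the covered vertices contribute at most 2 ν Δ.
--
-- Lower bound.  Call a vertex heavy if its degree exceeds α, and let H be the set of heavy
-- vertices.  The last α + 1 edges at each heavy vertex give (α + 1) |H| incidences, and at most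
-- α |H| edges run inside H, since a forest on H has at most |H| edges.  Hence at least |H| edges
-- of E_α meet H; all edges that avoid H lie in E_α, and a matching uses each vertex of H once.

open import Defs
open import Data.Bool using (Bool; true; false; _∧_; _∨_; not; if_then_else_)
import Data.Bool as Bool
open import Data.Bool.Properties using (¬-not)
open import Data.Nat using (ℕ; zero; suc; _≤_; _<_; _*_; _+_; _⊓_; _≤?_; _≟_; z≤n; s≤s)
open import Data.Nat.Properties hiding (suc-injective; _≟_; _≤?_)
open import Data.Fin using (Fin; zero; suc; toℕ; fromℕ<) renaming (_≟_ to _≟ᶠ_; _<?_ to _<?ᶠ_)
open import Data.Fin.Properties using (any?; all?; toℕ-inject₁; toℕ-fromℕ; toℕ-fromℕ<; toℕ<n; toℕ-injective; injective⇒≤; suc-injective)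
open import Data.Fin.Subset using (Subset; ∣_∣; _∈_)
open import Data.Fin.Subset.Properties using (anySubset?)
import Data.List as List
open import Data.Vec using ([]; _∷_; lookup; tabulate)
open import Data.Vec.Properties using (lookup∘tabulate; []=⇒lookup; lookup⇒[]=)
open import Data.Product using (_×_; _,_; proj₁; proj₂; ∃; ∃₂)
open import Data.Sum using (_⊎_; inj₁; inj₂)
open import Data.Empty using (⊥)
open import Function using (_∘_; id)
open import Relation.Nullary using (¬_; Dec; yes; no; does; contradiction)
open import Relation.Nullary.Decidable using (_×-dec_; _→-dec_; ¬?; dec-true; dec-false; map′; decidable-stable)
open import Relation.Unary using (Decidable)
open import Relation.Binary.PropositionalEquality using (_≡_; _≢_; refl; sym; trans; cong; cong₂; subst; module ≡-Reasoning)
open import Algebra.Properties.Semiring.Sum +-*-semiring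
  using (sum; sum-cong-≗; ∑-distrib-+; ∑-comm; *-distribˡ-sum; sum-replicate-zero)

-- Counting by sums of indicators.

does-true : ∀ {A : Set} (a? : Dec A) → does a? ≡ true → A
does-true (yes a) _ = a

m+m≤n+n⇒m≤n : ∀ {m n} → m + m ≤ n + n → m ≤ n
m+m≤n+n⇒m≤n m+m≤n+n = ≮⇒≥ λ n<m → <⇒≱ (+-mono-< n<m n<m) m+m≤n+n

χ : Bool → ℕ
χ true  = 1
χ false = 0

χ≤1 : ∀ b → χ b ≤ 1
χ≤1 true  = ≤-refl
χ≤1 false = z≤n

χ-mono : ∀ {b c} → (b ≡ true → c ≡ true) → χ b ≤ χ c
χ-mono {true}  b⇒c rewrite b⇒c refl = ≤-refl
χ-mono {false} b⇒c = z≤n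

χ-∧ : ∀ b c → χ (b ∧ c) ≡ χ b * χ c
χ-∧ true  c = sym (*-identityˡ (χ c))
χ-∧ false c = refl

∧-true : ∀ {b c} → b ∧ c ≡ true → b ≡ true × c ≡ true
∧-true {true} {true} _ = refl , refl

∑-mono : ∀ {n} {f g : Fin n → ℕ} → (∀ i → f i ≤ g i) → sum f ≤ sum g
∑-mono {zero}  f≤g = z≤n
∑-mono {suc n} f≤g = +-mono-≤ (f≤g zero) (∑-mono (f≤g ∘ suc))

∑-zero : ∀ {n} {f : Fin n → ℕ} → (∀ i → f i ≡ 0) → sum f ≡ 0
∑-zero {n} f≡0 = trans (sum-cong-≗ f≡0) (sum-replicate-zero n)

term≤∑ : ∀ {n} (f : Fin n → ℕ) i → f i ≤ sum f
term≤∑ f zero    = m≤m+n (f zero) _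
term≤∑ f (suc i) = ≤-trans (term≤∑ (f ∘ suc) i) (m≤n+m _ (f zero))

∑-const : ∀ n k → sum {n} (λ _ → k) ≡ n * k
∑-const zero    k = refl
∑-const (suc n) k = cong (k +_) (∑-const n k)

∑χ-member : ∀ {n} (p : Fin n → Bool) {i} → p i ≡ true → 1 ≤ sum (χ ∘ p)
∑χ-member p {i} pi = ≤-trans (≤-reflexive (sym (cong χ pi))) (term≤∑ (χ ∘ p) i)

∑χ-witness : ∀ {n} (p : Fin n → Bool) → 1 ≤ sum (χ ∘ p) → ∃ λ i → p i ≡ true
∑χ-witness {suc n} p 1≤ with p zero in eq
... | true  = zero , eq
... | false with ∑χ-witness (p ∘ suc) 1≤
...   | i , pi = suc i , pi

∑χ-witnesses : ∀ {n} (p : Fin n → Bool) → 2 ≤ sum (χ ∘ p) →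
  ∃₂ λ i j → i ≢ j × p i ≡ true × p j ≡ true
∑χ-witnesses {suc n} p 2≤ with p zero in eq
... | true with ∑χ-witness (p ∘ suc) (≤-pred 2≤)
...   | j , pj = zero , suc j , (λ ()) , eq , pj
∑χ-witnesses {suc n} p 2≤ | false with ∑χ-witnesses (p ∘ suc) 2≤
...   | i , j , i≢j , pi , pj = suc i , suc j , i≢j ∘ suc-injective , pi , pj

∑χ-unique : ∀ {n} (p : Fin n → Bool) →
  (∀ i j → p i ≡ true → p j ≡ true → i ≡ j) → sum (χ ∘ p) ≤ 1
∑χ-unique p unique with sum (χ ∘ p) ≤? 1
... | yes ≤1 = ≤1
... | no  ≰1 with ∑χ-witnesses p (≰⇒> ≰1)
...   | i , j , i≢j , pi , pj = contradiction (unique i j pi pj) i≢j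

∑-δ : ∀ {n} (a : Fin n) (g : Fin n → ℕ) → sum (λ u → χ (does (u ≟ᶠ a)) * g u) ≡ g a
∑-δ {suc n} zero g = trans (cong₂ _+_ (+-identityʳ (g zero)) (∑-zero {n} λ _ → refl)) (+-identityʳ (g zero))
∑-δ {suc n} (suc a) g = ∑-δ a (g ∘ suc)

∑-δ₁ : ∀ {n} (a : Fin n) → sum (λ u → χ (does (u ≟ᶠ a))) ≡ 1
∑-δ₁ {n} a = trans (sum-cong-≗ {n} (λ u → sym (*-identityʳ _))) (∑-δ a (λ _ → 1))

∑-pair : ∀ {n} {a b : Fin n} → a ≢ b → (g : Fin n → ℕ) →
  sum (λ u → χ (does (u ≟ᶠ a) ∨ does (u ≟ᶠ b)) * g u) ≡ g a + g b
∑-pair {n} {a} {b} a≢b g = begin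
  sum (λ u → χ (does (u ≟ᶠ a) ∨ does (u ≟ᶠ b)) * g u)
    ≡⟨ sum-cong-≗ split ⟩
  sum (λ u → χ (does (u ≟ᶠ a)) * g u + χ (does (u ≟ᶠ b)) * g u)
    ≡⟨ ∑-distrib-+ (λ u → χ (does (u ≟ᶠ a)) * g u) (λ u → χ (does (u ≟ᶠ b)) * g u) ⟩
  sum (λ u → χ (does (u ≟ᶠ a)) * g u) + sum (λ u → χ (does (u ≟ᶠ b)) * g u)
    ≡⟨ cong₂ _+_ (∑-δ a g) (∑-δ b g) ⟩
  g a + g b ∎
  where
  open ≡-Reasoning
  split : ∀ u → χ (does (u ≟ᶠ a) ∨ does (u ≟ᶠ b)) * g u ≡ χ (does (u ≟ᶠ a)) * g u + χ (does (u ≟ᶠ b)) * g u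
  split u with u ≟ᶠ a | u ≟ᶠ b
  ... | yes p | yes q = contradiction (trans (sym p) q) a≢b
  ... | yes p | no  q = sym (+-identityʳ _)
  ... | no  p | yes q = refl
  ... | no  p | no  q = refl

-- Serves both for deleting a vertex from a vertex set and for deleting an edge from an edge set.
_without_ : ∀ {n} → (Fin n → Bool) → Fin n → Fin n → Bool
(W without u) z = W z ∧ not (does (z ≟ᶠ u))

without-inv : ∀ {n} p (N : Fin n → Bool) {i} → (N without p) i ≡ true → N i ≡ true × i ≢ p
without-inv p N {i} q with i ≟ᶠ p | ∧-true {N i} q
... | no i≢p | Ni , _ = Ni , i≢p

∑-without : ∀ {n} (W : Fin n → Bool) {u} → W u ≡ true → sum (χ ∘ W) ≡ suc (sum (χ ∘ (W without u)))
∑-without W {u} Wu = begin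
  sum (χ ∘ W)
    ≡⟨ sum-cong-≗ split ⟩
  sum (λ z → χ (does (z ≟ᶠ u)) + χ ((W without u) z))
    ≡⟨ ∑-distrib-+ (λ z → χ (does (z ≟ᶠ u))) (χ ∘ (W without u)) ⟩
  sum (λ z → χ (does (z ≟ᶠ u))) + sum (χ ∘ (W without u))
    ≡⟨ cong (_+ sum (χ ∘ (W without u))) (∑-δ₁ u) ⟩
  suc (sum (χ ∘ (W without u))) ∎
  where
  open ≡-Reasoning
  split : ∀ z → χ (W z) ≡ χ (does (z ≟ᶠ u)) + χ ((W without u) z)
  split z with z ≟ᶠ u
  ... | yes refl rewrite Wu = refl
  ... | no  _ with W z
  ...   | true  = refl
  ...   | false = refl

length-filter-tabulate : ∀ {A : Set} {P : A → Set} (P? : Decidable P) {m} (f : Fin m → A) →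
  List.length (List.filter P? (List.tabulate f)) ≡ sum (λ i → χ (does (P? (f i))))
length-filter-tabulate P? {zero}  f = refl
length-filter-tabulate P? {suc m} f with does (P? (f zero))
... | true  = cong suc (length-filter-tabulate P? (f ∘ suc))
... | false = length-filter-tabulate P? (f ∘ suc)

count≡∑ : ∀ {m} {P : Fin m → Set} (P? : Decidable P) → count P? ≡ sum (λ i → χ (does (P? i)))
count≡∑ P? = length-filter-tabulate P? id

∣∣≡∑ : ∀ {m} (M : Subset m) → ∣ M ∣ ≡ sum (χ ∘ lookup M)
∣∣≡∑ []          = refl
∣∣≡∑ (true  ∷ M) = cong suc (∣∣≡∑ M)
∣∣≡∑ (false ∷ M) = ∣∣≡∑ M

later : ∀ {m} → (Fin m → Bool) → Fin m → ℕ
later p i = sum (λ j → χ (does (i <?ᶠ j) ∧ p j))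

-- The members with at most `α` later members are the last `α + 1`, or all of them if there are
-- fewer. In the induction the front member counts exactly when the remaining total `c` is at most
-- `α`, that is, when `c ⊓ suc α` has not yet reached its cap.
∑-last : ∀ {m} α (p : Fin m → Bool) →
  sum (λ i → χ (p i ∧ does (later p i ≤? α))) ≡ sum (χ ∘ p) ⊓ suc α
∑-last {zero}  α p = refl
∑-last {suc m} α p rewrite ∑-last α (p ∘ suc) = first (p zero) (sum (χ ∘ p ∘ suc))
  where
  first : ∀ b c → χ (b ∧ does (c ≤? α)) + c ⊓ suc α ≡ (χ b + c) ⊓ suc α
  first false c = refl
  first true  c with c ≤? α
  ... | yes c≤α rewrite dec-true (c ≤? α) c≤α = cong suc (trans (m≤n⇒m⊓n≡m (m≤n⇒m≤1+n c≤α)) (sym (m≤n⇒m⊓n≡m c≤α)))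
  ... | no  c≰α rewrite dec-false (c ≤? α) c≰α = trans (m≥n⇒m⊓n≡n (≰⇒> c≰α)) (cong suc (sym (m≥n⇒m⊓n≡n (<⇒≤ (≰⇒> c≰α)))))

-- Incidence, and the consequences of simplicity.

module EdgeStream {n m : ℕ} (e : Stream n m) (simple : SimpleStream e) where

  src tgt : Fin m → Fin n
  src i = proj₁ (e i)
  tgt i = proj₂ (e i)

  inc : Fin n → Fin m → Bool
  inc u i = does (incident? u (e i))

  inc⇒Incident : ∀ {u i} → inc u i ≡ true → Incident u (e i)
  inc⇒Incident {u} {i} = does-true (incident? u (e i))

  Incident⇒inc : ∀ {u i} → Incident u (e i) → inc u i ≡ true
  Incident⇒inc {u} {i} = dec-true (incident? u (e i))

  -- Exchange the two sums: as there are no loops, each edge meets exactly two vertices. The weight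
  -- may depend on the edge and on the end, so that every double count below is an instance.
  handshake : (g : Fin m → Fin n → ℕ) →
    sum (λ u → sum (λ i → χ (inc u i) * g i u)) ≡ sum (λ i → g i (src i) + g i (tgt i))
  handshake g = trans (∑-comm {n} {m} (λ u i → χ (inc u i) * g i u))
    (sum-cong-≗ λ i → ∑-pair (proj₁ simple i) (g i))

  -- The far end of edge `i` seen from `u`. If `u` is not on the edge the value is `src i`, which
  -- still makes `Incident-other` unconditional.
  other : Fin n → Fin m → Fin n
  other u i = if does (u ≟ᶠ src i) then tgt i else src i

  other-src : ∀ i → other (src i) i ≡ tgt i
  other-src i rewrite dec-true (src i ≟ᶠ src i) refl = refl

  other-tgt : ∀ i → other (tgt i) i ≡ src i
  other-tgt i rewrite dec-false (tgt i ≟ᶠ src i) (proj₁ simple i ∘ sym) = refl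

  Incident-other : ∀ u i → Incident (other u i) (e i)
  Incident-other u i with does (u ≟ᶠ src i)
  ... | true  = inj₂ refl
  ... | false = inj₁ refl

  other≢ : ∀ {u i} → Incident u (e i) → other u i ≢ u
  other≢ {i = i} (inj₁ refl) eq = proj₁ simple i (trans (sym eq) (other-src i))
  other≢ {i = i} (inj₂ refl) eq = proj₁ simple i (trans (sym (other-tgt i)) eq)

  endpoint : ∀ {u z i} → Incident u (e i) → Incident z (e i) → z ≡ u ⊎ z ≡ other u i
  endpoint (inj₁ refl) (inj₁ z≡) = inj₁ z≡
  endpoint {i = i} (inj₁ refl) (inj₂ z≡) = inj₂ (trans z≡ (sym (other-src i)))
  endpoint {i = i} (inj₂ refl) (inj₁ z≡) = inj₂ (trans z≡ (sym (other-tgt i)))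
  endpoint (inj₂ refl) (inj₂ z≡) = inj₁ z≡

  other-SameEdge : ∀ {u i} → Incident u (e i) → SameEdge (e i) (other u i , u)
  other-SameEdge {i = i} (inj₁ refl) = inj₂ (refl , sym (other-src i))
  other-SameEdge {i = i} (inj₂ refl) = inj₁ (sym (other-tgt i) , refl)

  -- Two edges at `u` with the same far end join the same pair of vertices, and the stream contains
  -- each edge only once.
  other-injective : ∀ {u i j} → Incident u (e i) → Incident u (e j) → other u i ≡ other u j → i ≡ j
  other-injective {u} {i} {j} ui uj eq = proj₂ simple i j
    (merge (other-SameEdge ui) (subst (λ x → SameEdge (e j) (x , u)) (sym eq) (other-SameEdge uj)))
    where
    merge : ∀ {x y z : Fin n × Fin n} → SameEdge x z → SameEdge y z → SameEdge x y
    merge (inj₁ (refl , refl)) (inj₁ (refl , refl)) = inj₁ (refl , refl)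
    merge (inj₁ (refl , refl)) (inj₂ (refl , refl)) = inj₂ (refl , refl)
    merge (inj₂ (refl , refl)) (inj₁ (refl , refl)) = inj₂ (refl , refl)
    merge (inj₂ (refl , refl)) (inj₂ (refl , refl)) = inj₁ (refl , refl)

  -- Forests

  module _ {P : Fin m → Set} where

    -- A path is f 0, …, f L; it grows at the end f 0.  The values of f beyond L are
    -- irrelevant, except that excluding f 1 must be harmless when L = 0.
    longest-path-cycle : (W : Fin n → Bool) →
      (∀ u z → W u ≡ true → ∃ λ x → W x ≡ true × x ≢ u × x ≢ z × AdjIn e P x u) →
      ∀ fuel L (f : ℕ → Fin n) → n ≤ fuel + L → W (f 0) ≡ true →
      (∀ i j → i ≤ L → j ≤ L → f i ≡ f j → i ≡ j) →
      (∀ i → i < L → AdjIn e P (f i) (f (suc i))) → HasCycle e P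
    -- Without fuel `n ≤ L`, while `f 0, …, f L` are `L + 1` distinct vertices.
    longest-path-cycle W next zero L f n≤L _ inj _ =
      contradiction (≤-trans (injective⇒≤ {f = f ∘ toℕ {suc L}}
        (λ {i} {j} eq → toℕ-injective (inj _ _ (≤-pred (toℕ<n i)) (≤-pred (toℕ<n j)) eq))) n≤L) 1+n≰n
    longest-path-cycle W next (suc fuel) L f n≤ Wf₀ inj adj
      with next (f 0) (f 1) Wf₀
    ... | x , Wx , x≢f₀ , x≢f₁ , x~f₀ with any? {suc L} (λ j → x ≟ᶠ f (toℕ j))
    ...   | yes (j , x≡fj) = close (toℕ j) (≤-pred (toℕ<n j)) x≡fj
      where
      close : ∀ j → j ≤ L → x ≡ f j → HasCycle e P
      close 0 _ eq = contradiction eq x≢f₀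
      close 1 _ eq = contradiction eq x≢f₁
      -- Since `x` avoids `f 0` and `f 1`, it can only return at an index `2 + k`, so the cycle has
      -- the required `3 + k` vertices.
      close (suc (suc k)) j≤L eq = k , f ∘ toℕ
        , (λ {i} {j} eq → toℕ-injective (inj _ _ (bound i) (bound j) eq))
        , (λ i → subst (λ t → AdjIn e P (f t) (f (suc (toℕ i)))) (sym (toℕ-inject₁ i))
                   (adj (toℕ i) (<-≤-trans (toℕ<n i) j≤L)))
        , subst (λ v → AdjIn e P v (f 0)) (trans eq (cong (λ t → f (2 + t)) (sym (toℕ-fromℕ k)))) x~f₀
        where
        bound : (i : Fin (3 + k)) → toℕ i ≤ L
        bound i = ≤-trans (≤-pred (toℕ<n i)) j≤L
    ...   | no x∉f = longest-path-cycle W next fuel (suc L) f′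
                       (≤-trans n≤ (≤-reflexive (sym (+-suc fuel L)))) Wx inj′ adj′
      where
      f′ : ℕ → Fin n
      f′ zero    = x
      f′ (suc i) = f i
      fresh : ∀ j → j ≤ L → x ≢ f j
      fresh j j≤L eq = x∉f (fromℕ< (s≤s j≤L) , trans eq (cong f (sym (toℕ-fromℕ< (s≤s j≤L)))))
      inj′ : ∀ i j → i ≤ suc L → j ≤ suc L → f′ i ≡ f′ j → i ≡ j
      inj′ zero    zero    _ _ _ = refl
      inj′ zero    (suc j) _ j≤ eq = contradiction eq (fresh j (≤-pred j≤))
      inj′ (suc i) zero    i≤ _ eq = contradiction (sym eq) (fresh i (≤-pred i≤))
      inj′ (suc i) (suc j) i≤ j≤ eq = cong suc (inj i j (≤-pred i≤) (≤-pred j≤) eq)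
      adj′ : ∀ i → i < suc L → AdjIn e P (f′ i) (f′ (suc i))
      adj′ zero    _  = x~f₀
      adj′ (suc i) i< = adj i (≤-pred i<)

    module _ (P? : Decidable P) (forest : IsForest e P) where

      within : (Fin n → Bool) → Fin m → Bool
      within W i = does (P? i) ∧ (W (src i) ∧ W (tgt i))

      degree-within : (Fin n → Bool) → Fin n → ℕ
      degree-within W u = sum (λ i → χ (inc u i ∧ within W i))

      within-without : ∀ W u →
        sum (χ ∘ within W) ≤ sum (χ ∘ within (W without u)) + degree-within W u
      within-without W u = ≤-trans (∑-mono split) (≤-reflexive (∑-distrib-+ (χ ∘ within (W without u)) _))
        where
        split : ∀ i → χ (within W i) ≤ χ (within (W without u) i) + χ (inc u i ∧ within W i)
        split i with does (P? i) | W (src i) | W (tgt i)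
        ... | false | _     | _     = z≤n
        ... | true  | false | _     = z≤n
        ... | true  | true  | false = z≤n
        ... | true  | true  | true with src i ≟ᶠ u | tgt i ≟ᶠ u
        ...   | yes refl | _        rewrite dec-true (src i ≟ᶠ src i) refl = ≤-refl
        ...   | no _     | yes refl rewrite Incident⇒inc {tgt i} {i} (inj₂ refl) = ≤-refl
        ...   | no _     | no _     = s≤s z≤n

      -- Two different edges at `u` have different far ends, so at least one of these ends avoids
      -- the excluded vertex `z`. This supplies the extension step of `longest-path-cycle`.
      neighbour : ∀ W → (∀ u → W u ≡ true → 2 ≤ degree-within W u) →
        ∀ u z → W u ≡ true → ∃ λ x → W x ≡ true × x ≢ u × x ≢ z × AdjIn e P x u
      neighbour W deg≥2 u z Wu = choose (∑χ-witnesses (λ i → inc u i ∧ within W i) (deg≥2 u Wu))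
        where
        Goal : Set
        Goal = ∃ λ x → W x ≡ true × x ≢ u × x ≢ z × AdjIn e P x u

        W-other : ∀ i → W (src i) ∧ W (tgt i) ≡ true → W (other u i) ≡ true
        W-other i ws with Incident-other u i
        ... | inj₁ eq = trans (cong W eq) (proj₁ (∧-true ws))
        ... | inj₂ eq = trans (cong W eq) (proj₂ (∧-true {W (src i)} ws))

        avoid : ∀ i → inc u i ∧ within W i ≡ true → other u i ≢ z → Goal
        avoid i p ≢z with ∧-true {inc u i} p
        ... | ui , wi with ∧-true {does (P? i)} wi
        ...   | Pi , ws = other u i , W-other i ws , other≢ (inc⇒Incident ui) , ≢z
                        , i , does-true (P? i) Pi , other-SameEdge (inc⇒Incident ui)

        choose : (∃₂ λ i j → i ≢ j × inc u i ∧ within W i ≡ true × inc u j ∧ within W j ≡ true) → Goal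
        choose (i , j , i≢j , pi , pj) with other u i ≟ᶠ z | other u j ≟ᶠ z
        ... | no  ≢z | _      = avoid i pi ≢z
        ... | yes _  | no  ≢z = avoid j pj ≢z
        ... | yes p  | yes q  = contradiction (other-injective {u} {i} {j}
                (inc⇒Incident (proj₁ (∧-true {inc u i} pi))) (inc⇒Incident (proj₁ (∧-true {inc u j} pj)))
                (trans p (sym q))) i≢j

      -- Induction by removing a vertex of degree at most 1. If there is none, a nonempty `W` has
      -- minimum degree 2 and yields a cycle, and an empty `W` spans no edge. The bound `k` instead
      -- of `k - 1` lets the empty set be included.
      forest-bound : ∀ k W → sum (χ ∘ W) ≡ k → sum (χ ∘ within W) ≤ k
      forest-bound k W ∣W∣ with any? (λ u → (W u Bool.≟ true) ×-dec (degree-within W u ≤? 1))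
      forest-bound zero W ∣W∣ | yes (u , Wu , _) =
        contradiction (trans (sym (∑-without W Wu)) ∣W∣) λ ()
      forest-bound (suc k) W ∣W∣ | yes (u , Wu , d≤1) = begin
        sum (χ ∘ within W)                                   ≤⟨ within-without W u ⟩
        sum (χ ∘ within (W without u)) + degree-within W u   ≤⟨ +-mono-≤ (forest-bound k (W without u)
                                                                  (cong Data.Nat.pred (trans (sym (∑-without W Wu)) ∣W∣))) d≤1 ⟩
        k + 1                                                ≡⟨ +-comm k 1 ⟩
        suc k                                                ∎
        where open ≤-Reasoning
      forest-bound k W ∣W∣ | no ¬leaf with any? (λ u → W u Bool.≟ true)
      ... | yes (u , Wu) = contradiction
              -- The path starts as a single vertex. The constant function makes `f 1` equal to
              -- `f 0`, so excluding `f 1` excludes nothing new.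
              (longest-path-cycle W (neighbour W λ u Wu → ≰⇒> λ d≤1 → ¬leaf (u , Wu , d≤1))
                n 0 (λ _ → u) (m≤m+n n 0) Wu (λ { zero zero _ _ _ → refl }) (λ _ ()))
              forest
      ... | no ¬W = ≤-trans (≤-reflexive (∑-zero λ i → cong χ (¬-not (λ wi →
              ¬W (src i , proj₁ (∧-true (proj₂ (∧-true {does (P? i)} wi)))))))) z≤n

  ∑-colours : ∀ {α} (col : Fin m → Fin α) (p : Fin m → Bool) →
    sum (λ c → sum (λ i → χ (does (c ≟ᶠ col i) ∧ p i))) ≡ sum (χ ∘ p)
  ∑-colours {α} col p = trans (∑-comm {α} {m} _) (sum-cong-≗ {m} λ i →
    trans (sum-cong-≗ {α} λ c → χ-∧ (does (c ≟ᶠ col i)) (p i)) (∑-δ (col i) (λ _ → χ (p i))))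

  arboricity-bound : ∀ {α} → ArboricityAtMost α e → (W : Fin n → Bool) →
    sum (λ i → χ (W (src i) ∧ W (tgt i))) ≤ α * sum (χ ∘ W)
  arboricity-bound {α} (col , forest) W = begin
    sum (λ i → χ (W (src i) ∧ W (tgt i)))
      ≡⟨ ∑-colours col (λ i → W (src i) ∧ W (tgt i)) ⟨
    sum (λ c → sum (λ i → χ (does (c ≟ᶠ col i) ∧ (W (src i) ∧ W (tgt i)))))
      -- `map′ sym sym` turns the test `c ≟ᶠ col i`, oriented for `∑-δ`, into a decision of the
      -- class `col i ≡ c` while keeping its Boolean.
      ≤⟨ ∑-mono {α} (λ c → forest-bound (λ i → map′ sym sym (c ≟ᶠ col i)) (forest c) _ W refl) ⟩
    sum {α} (λ _ → sum (χ ∘ W))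
      ≡⟨ ∑-const α (sum (χ ∘ W)) ⟩
    α * sum (χ ∘ W) ∎
    where open ≤-Reasoning

  -- Heavy vertices and the edges of E_α.

  degree : Fin n → ℕ
  degree u = sum (χ ∘ inc u)

  module _ (α : ℕ) where

    late : Fin n → Fin m → Bool
    late u i = does (later (inc u) i ≤? α)

    sizeEα≡∑ : sizeEα α e ≡ sum (λ i → χ (late (src i) i ∧ late (tgt i) i))
    sizeEα≡∑ = trans (count≡∑ (inEα? α e)) (sum-cong-≗ {m} λ i → cong χ (cong₂ _∧_
      (cong (λ k → does (k ≤? α)) (count≡∑ (λ j → (i <?ᶠ j) ×-dec incident? (src i) (e j))))
      (cong (λ k → does (k ≤? α)) (count≡∑ (λ j → (i <?ᶠ j) ×-dec incident? (tgt i) (e j))))))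

    later≤degree : ∀ u i → later (inc u) i ≤ degree u
    later≤degree u i = ∑-mono {m} λ j → χ-mono (proj₂ ∘ ∧-true {does (i <?ᶠ j)})

    heavy : Fin n → Bool
    heavy u = does (suc α ≤? degree u)

    light-late : ∀ u i → heavy u ≡ false → late u i ≡ true
    light-late u i light = dec-true (later (inc u) i ≤? α) (≤-trans (later≤degree u i)
      (≮⇒≥ λ α<d → contradiction (trans (sym light) (dec-true (suc α ≤? degree u) α<d)) λ ()))

    -- At a heavy vertex the cap in `∑-last` is attained, giving `α + 1` late edges; at a light
    -- vertex the left side vanishes.
    heavy-late : ∀ u → suc α * χ (heavy u) ≤ sum (λ i → χ (inc u i) * χ (heavy u ∧ late u i))
    heavy-late u with heavy u in eq
    ... | false = ≤-trans (≤-reflexive (*-zeroʳ α)) z≤n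
    ... | true  = begin
      suc α * 1                                  ≡⟨ *-identityʳ (suc α) ⟩
      suc α                                      ≡⟨ m≥n⇒m⊓n≡n (does-true (suc α ≤? degree u) eq) ⟨
      degree u ⊓ suc α                           ≡⟨ ∑-last α (inc u) ⟨
      sum (λ i → χ (inc u i ∧ late u i))         ≡⟨ sum-cong-≗ {m} (λ i → χ-∧ (inc u i) (late u i)) ⟩
      sum (λ i → χ (inc u i) * χ (late u i))     ∎
      where open ≤-Reasoning

    light : Fin m → Bool
    light i = not (heavy (src i)) ∧ not (heavy (tgt i))

    -- Count, for each heavy vertex, its last α + 1 edges.  An edge is counted twice only if
    -- both ends are heavy and it lies in E_α, and it is counted without lying in E_α only
    -- if both ends are heavy.
    heavy+light≤Eα : ArboricityAtMost α e →
      sum (χ ∘ heavy) + sum (χ ∘ light) ≤ sizeEα α e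
    -- Adding `α * H` to both sides leaves room for the edges inside the heavy set without any
    -- subtraction.
    heavy+light≤Eα arb = +-cancelˡ-≤ (α * H) (H + sum (χ ∘ light)) (sizeEα α e) (begin
      α * H + (H + sum (χ ∘ light))
        ≡⟨ +-assoc (α * H) H _ ⟨
      α * H + H + sum (χ ∘ light)
        ≡⟨ cong (_+ sum (χ ∘ light)) (+-comm (α * H) H) ⟩
      suc α * H + sum (χ ∘ light)
        ≡⟨ cong (_+ sum (χ ∘ light)) (*-distribˡ-sum (suc α) (χ ∘ heavy)) ⟩
      sum (λ u → suc α * χ (heavy u)) + sum (χ ∘ light)
        ≤⟨ +-monoˡ-≤ _ (∑-mono heavy-late) ⟩
      sum (λ u → sum (λ i → χ (inc u i) * χ (heavy u ∧ late u i))) + sum (χ ∘ light)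
        ≡⟨ cong (_+ sum (χ ∘ light)) (handshake (λ i u → χ (heavy u ∧ late u i))) ⟩
      sum (λ i → χ (heavy (src i) ∧ late (src i) i) + χ (heavy (tgt i) ∧ late (tgt i) i)) + sum (χ ∘ light)
        ≡⟨ ∑-distrib-+ {m} _ (χ ∘ light) ⟨
      sum (λ i → χ (heavy (src i) ∧ late (src i) i) + χ (heavy (tgt i) ∧ late (tgt i) i) + χ (light i))
        ≤⟨ ∑-mono {m} (λ i → per-edge _ _ _ _ (light-late (src i) i) (light-late (tgt i) i)) ⟩
      sum (λ i → χ (heavy (src i) ∧ heavy (tgt i)) + χ (late (src i) i ∧ late (tgt i) i))
        ≡⟨ ∑-distrib-+ {m} _ _ ⟩
      sum (λ i → χ (heavy (src i) ∧ heavy (tgt i))) + sum (λ i → χ (late (src i) i ∧ late (tgt i) i))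
        ≤⟨ +-mono-≤ (arboricity-bound arb heavy) (≤-reflexive (sym sizeEα≡∑)) ⟩
      α * H + sizeEα α e ∎)
      where
      open ≤-Reasoning
      H = sum (χ ∘ heavy)
      -- An edge is late at each light end. So with a light end the edge lies in E_α exactly when it
      -- is late at the other end; with two heavy ends the extra 1 on the right pays for the
      -- possible excess.
      per-edge : ∀ h h′ l l′ → (h ≡ false → l ≡ true) → (h′ ≡ false → l′ ≡ true) →
        χ (h ∧ l) + χ (h′ ∧ l′) + χ (not h ∧ not h′) ≤ χ (h ∧ h′) + χ (l ∧ l′)
      per-edge false false l     l′    p q rewrite p refl | q refl = ≤-refl
      per-edge false true  l     false p q = z≤n
      per-edge false true  l     true  p q rewrite p refl = ≤-refl
      per-edge true  false false l′    p q = z≤n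
      per-edge true  false true  l′    p q rewrite q refl = ≤-refl
      per-edge true  true  false false p q = z≤n
      per-edge true  true  false true  p q = ≤-refl
      per-edge true  true  true  false p q = ≤-refl
      per-edge true  true  true  true  p q = ≤-refl

  -- Matchings

  Misses : (Fin m → Bool) → Fin n → Set
  Misses N w = ∀ i → N i ≡ true → ¬ Incident w (e i)

  -- The ambient edge set `S` is a parameter because the upper bound is proved for subgraphs, by
  -- induction on vertex deletion.
  record _MatchingIn_ (N S : Fin m → Bool) : Set where
    field
      ⊆S       : ∀ i → N i ≡ true → S i ≡ true
      disjoint : ∀ u i j → N i ≡ true → N j ≡ true → Incident u (e i) → Incident u (e j) → i ≡ j
  open _MatchingIn_

  size : (Fin m → Bool) → ℕ
  size N = sum (χ ∘ N)

  -- The degree of `u` in the edge set `N`. For a matching it is 0 or 1 and tells whether `u` is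
  -- covered.
  cover : (Fin m → Bool) → Fin n → ℕ
  cover N u = sum (λ i → χ (inc u i ∧ N i))

  ∑-cover : ∀ N → sum (cover N) ≡ size N + size N
  ∑-cover N = trans (sum-cong-≗ {n} λ u → sum-cong-≗ {m} λ i → χ-∧ (inc u i) (N i))
    (trans (handshake (λ i _ → χ (N i))) (∑-distrib-+ (χ ∘ N) (χ ∘ N)))

  cover≤1 : ∀ {N S} → N MatchingIn S → ∀ u → cover N u ≤ 1
  cover≤1 {N} NS u = ∑χ-unique (λ i → inc u i ∧ N i) λ i j p q →
    let ui , Ni = ∧-true {inc u i} p
        uj , Nj = ∧-true {inc u j} q
    in disjoint NS u i j Ni Nj (inc⇒Incident ui) (inc⇒Incident uj)

  covering-edge : ∀ N u → 1 ≤ cover N u → ∃ λ i → N i ≡ true × Incident u (e i)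
  covering-edge N u 1≤ with ∑χ-witness (λ i → inc u i ∧ N i) 1≤
  ... | i , p with ∧-true {inc u i} p
  ...   | ui , Ni = i , Ni , inc⇒Incident ui

  cover≡0⇒Misses : ∀ N u → cover N u ≡ 0 → Misses N u
  cover≡0⇒Misses N u c≡0 i Ni ui = 1+n≰n (≤-trans
    (∑χ-member (λ i → inc u i ∧ N i) {i} (cong₂ _∧_ (Incident⇒inc ui) Ni)) (≤-reflexive c≡0))

  Misses⇒cover≡0 : ∀ N u → Misses N u → cover N u ≡ 0
  Misses⇒cover≡0 N u miss = n≤0⇒n≡0 (≮⇒≥ λ 1≤ →
    let i , Ni , ui = covering-edge N u 1≤ in miss i Ni ui)

  MatchingIn? : ∀ N S → Dec (N MatchingIn S)
  MatchingIn? N S = map′ (λ (p , q) → record { ⊆S = p ; disjoint = q }) (λ NS → ⊆S NS , disjoint NS)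
    (all? (λ i → (N i Bool.≟ true) →-dec (S i Bool.≟ true)) ×-dec
     all? (λ u → all? λ i → all? λ j → (N i Bool.≟ true) →-dec (N j Bool.≟ true) →-dec
       incident? u (e i) →-dec incident? u (e j) →-dec (i ≟ᶠ j)))

  cong-MatchingIn : ∀ {N N′ S} → (∀ i → N′ i ≡ N i) → N MatchingIn S → N′ MatchingIn S
  cong-MatchingIn eq NS = record
    { ⊆S       = λ i N′i → ⊆S NS i (trans (sym (eq i)) N′i)
    ; disjoint = λ u i j N′i N′j → disjoint NS u i j (trans (sym (eq i)) N′i) (trans (sym (eq j)) N′j)
    }

  -- An exhaustive search over `Subset m`. Since `Q` sees only the size, it transfers along the
  -- pointwise equality of `N` with its tabulation.
  anyMatching? : ∀ S {Q : ℕ → Set} → Decidable Q → Dec (∃ λ N → N MatchingIn S × Q (size N))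
  anyMatching? S {Q} Q? = map′ (λ (N , p) → lookup N , p)
    (λ (N , NS , QN) → tabulate N , cong-MatchingIn (lookup∘tabulate N) NS
      , subst Q (sym (sum-cong-≗ {m} λ i → cong χ (lookup∘tabulate N i))) QN)
    (anySubset? (λ N → MatchingIn? (lookup N) S ×-dec Q? (size (lookup N))))

  insert : Fin m → (Fin m → Bool) → Fin m → Bool
  insert p N i = does (i ≟ᶠ p) ∨ N i

  insert-inv : ∀ p N {i} → insert p N i ≡ true → i ≡ p ⊎ N i ≡ true
  insert-inv p N {i} q with i ≟ᶠ p
  ... | yes i≡p = inj₁ i≡p
  ... | no  _   = inj₂ q

  insert-matching : ∀ {N S p} → N MatchingIn S → S p ≡ true →
    (∀ u → Incident u (e p) → Misses N u) → insert p N MatchingIn S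
  insert-matching {N} {S} {p} NS Sp miss = record { ⊆S = sub ; disjoint = dis }
    where
    sub : ∀ i → insert p N i ≡ true → S i ≡ true
    sub i q with insert-inv p N {i} q
    ... | inj₁ refl = Sp
    ... | inj₂ Ni   = ⊆S NS i Ni
    dis : ∀ u i j → insert p N i ≡ true → insert p N j ≡ true →
      Incident u (e i) → Incident u (e j) → i ≡ j
    dis u i j qi qj ui uj with insert-inv p N {i} qi | insert-inv p N {j} qj
    ... | inj₁ refl | inj₁ refl = refl
    ... | inj₁ refl | inj₂ Nj   = contradiction uj (miss u ui j Nj)
    ... | inj₂ Ni   | inj₁ refl = contradiction ui (miss u uj i Ni)
    ... | inj₂ Ni   | inj₂ Nj   = disjoint NS u i j Ni Nj ui uj

  size-insert : ∀ p N → N p ≡ false → size (insert p N) ≡ suc (size N)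
  size-insert p N Np = trans (sum-cong-≗ {m} split)
    (trans (∑-distrib-+ {m} (λ i → χ (does (i ≟ᶠ p))) (χ ∘ N)) (cong (_+ size N) (∑-δ₁ p)))
    where
    split : ∀ i → χ (insert p N i) ≡ χ (does (i ≟ᶠ p)) + χ (N i)
    split i with i ≟ᶠ p
    ... | yes refl rewrite Np = refl
    ... | no  _    = refl

  without-matching : ∀ {N S} p → N MatchingIn S → (N without p) MatchingIn S
  without-matching {N} p NS = record
    { ⊆S       = λ i q → ⊆S NS i (proj₁ (without-inv p N q))
    ; disjoint = λ u i j qi qj → disjoint NS u i j (proj₁ (without-inv p N qi)) (proj₁ (without-inv p N qj))
    }

  Misses-edge : ∀ {N u i} → Misses N u → Incident u (e i) → N i ≡ false
  Misses-edge miss ui = ¬-not λ Ni → miss _ Ni ui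

  edge-misses : ∀ {N u i} → Incident u (e i) → Misses N u → Misses N (other u i) →
    ∀ z → Incident z (e i) → Misses N z
  edge-misses ui mu mo z zi with endpoint ui zi
  ... | inj₁ refl = mu
  ... | inj₂ refl = mo

  -- Replace `yz` by `xy` in `N`. The edge `xy` is not in `N`, which misses `x`, and `yz` is not in
  -- `M`, as it meets `xy ∈ M` in `y`; so the size is kept and the intersection with `M` grows. The
  -- vertex `w` stays missed: it is not `x`, and not `y`, which `N` covers.
  exchange : ∀ {M N S w x xy yz} → M MatchingIn S → N MatchingIn S → Misses N w → x ≢ w →
    M xy ≡ true → Incident x (e xy) → Misses N x → N yz ≡ true → Incident (other x xy) (e yz) →
    ∃ λ N′ → N′ MatchingIn S × size N′ ≡ size N × Misses N′ w ×
      size (λ i → M i ∧ N i) < size (λ i → M i ∧ N′ i)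
  exchange {M} {N} {S} {w} {x} {xy} {yz} MS NS Nw x≢w Mxy x∈xy Nx Nyz y∈yz = N′ , N′S , same , N′w , more
    where
    y = other x xy
    y∈xy = Incident-other x xy
    Nxy : N xy ≡ false
    Nxy = Misses-edge Nx x∈xy
    xy≢yz : xy ≢ yz
    xy≢yz eq = contradiction (trans (sym Nxy) (trans (cong N eq) Nyz)) λ ()
    Myz : M yz ≡ false
    Myz = ¬-not λ Myz → xy≢yz (disjoint MS y xy yz Mxy Myz y∈xy y∈yz)
    D = N without yz
    N′ = insert xy D
    D⊆N : ∀ {i} → D i ≡ true → N i ≡ true
    D⊆N = proj₁ ∘ without-inv yz N
    Dx : Misses D x
    Dx i Di = Nx i (D⊆N Di)
    Dy : Misses D y
    Dy i Di y∈i = proj₂ (without-inv yz N Di) (disjoint NS y i yz (D⊆N Di) Nyz y∈i y∈yz)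
    N′S : N′ MatchingIn S
    N′S = insert-matching (without-matching yz NS) (⊆S MS xy Mxy) (edge-misses x∈xy Dx Dy)
    same : size N′ ≡ size N
    same = trans (size-insert xy D (Misses-edge Dx x∈xy)) (sym (∑-without N Nyz))
    N′w : Misses N′ w
    N′w i N′i wi with insert-inv xy D {i} N′i
    ... | inj₂ Di = Nw i (D⊆N Di) wi
    ... | inj₁ refl with endpoint x∈xy wi
    ...   | inj₁ w≡x = x≢w (sym w≡x)
    ...   | inj₂ w≡y = Nw yz Nyz (subst (λ t → Incident t (e yz)) (sym w≡y) y∈yz)
    more : size (λ i → M i ∧ N i) < size (λ i → M i ∧ N′ i)
    more = ≤-trans (≤-reflexive (sym (size-insert xy (λ i → M i ∧ N i) (cong₂ _∧_ Mxy Nxy))))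
      (∑-mono {m} split)
      where
      split : ∀ i → χ (insert xy (λ j → M j ∧ N j) i) ≤ χ (M i ∧ N′ i)
      split i with i ≟ᶠ xy | i ≟ᶠ yz
      ... | yes refl | _        rewrite Mxy = ≤-refl
      ... | no _     | yes refl rewrite Myz = z≤n
      ... | no _     | no _     with N i
      ...   | true  = ≤-refl
      ...   | false = ≤-refl

  -- Gallai's exchange argument and the critical case.

  module _ (S : Fin m → Bool) (k : ℕ) (≤k : ∀ N → N MatchingIn S → size N ≤ k) where

    -- Otherwise the edge `i` could be added to `N`, giving a matching with more than `k` edges.
    neighbour-covered : ∀ {N u i} → N MatchingIn S → k ≤ size N → S i ≡ true →
      Incident u (e i) → Misses N u → 1 ≤ cover N (other u i)
    neighbour-covered {N} {u} {i} NS k≤ Si ui mu = n≢0⇒n>0 λ c≡0 → 1+n≰n (begin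
      suc k               ≤⟨ s≤s k≤ ⟩
      suc (size N)        ≡⟨ size-insert i N (Misses-edge mu ui) ⟨
      size (insert i N)   ≤⟨ ≤k _ (insert-matching NS Si
                               (edge-misses ui mu (cover≡0⇒Misses N (other u i) c≡0))) ⟩
      k                   ∎)
      where open ≤-Reasoning

    -- The heart of Gallai's lemma: among the maximum matchings N missing w, one with the largest
    -- intersection with M could still be improved.  Some x ≠ w is covered by M but
    -- not by N; if xy ∈ M then y is covered by some yz ∈ N, and N − yz + xy meets M in one
    -- more edge.
    no-two-missed-neighbours : ∀ {M} → M MatchingIn S → k ≤ size M →
      ∀ {u v w p q} → S p ≡ true → S q ≡ true → Incident w (e p) → Incident w (e q) →
      other w p ≡ u → other w q ≡ v → u ≢ v → Misses M u → Misses M v →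
      ∀ fuel {N} → size M ≤ fuel + size (λ i → M i ∧ N i) →
      N MatchingIn S → k ≤ size N → ¬ Misses N w
    no-two-missed-neighbours {M} MS k≤M {u} {v} {w} {p} {q} Sp Sq wp wq refl refl u≢v Mu Mv = go
      where
      module _ {N : Fin m → Bool} (NS : N MatchingIn S) (k≤N : k ≤ size N) (Nw : Misses N w) where

        -- If there were none, `N` would cover every vertex other than `w` that `M` covers. It also
        -- covers `u` and `v`, neighbours of the missed `w`, and `M` covers neither of them.
        -- Counting covered vertices, with one unit of slack for `w`, gives `2 + 2|M| ≤ 1 + 2|N|`,
        -- against `|N| ≤ |M|`.
        exchange-vertex : ∃ λ x → x ≢ w × 1 ≤ cover M x × cover N x ≡ 0
        exchange-vertex with any? (λ x → ¬? (x ≟ᶠ w) ×-dec (1 ≤? cover M x) ×-dec (cover N x ≟ 0))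
        ... | yes found = found
        ... | no ¬found = contradiction (begin
          2 + (size N + size N)
            ≤⟨ +-monoʳ-≤ 2 (+-mono-≤ N≤M N≤M) ⟩
          2 + (size M + size M)
            ≡⟨ cong (2 +_) (∑-cover M) ⟨
          1 + 1 + sum (cover M)
            ≡⟨ cong₂ (λ s t → s + t + sum (cover M)) (∑-δ₁ u) (∑-δ₁ v) ⟨
          sum (λ z → χ (does (z ≟ᶠ u))) + sum (λ z → χ (does (z ≟ᶠ v))) + sum (cover M)
            ≡⟨ cong (_+ sum (cover M)) (∑-distrib-+ {n} (λ z → χ (does (z ≟ᶠ u))) _) ⟨
          sum (λ z → χ (does (z ≟ᶠ u)) + χ (does (z ≟ᶠ v))) + sum (cover M)
            ≡⟨ ∑-distrib-+ {n} _ (cover M) ⟨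
          sum (λ z → χ (does (z ≟ᶠ u)) + χ (does (z ≟ᶠ v)) + cover M z)
            ≤⟨ ∑-mono {n} compare ⟩
          sum (λ z → χ (does (z ≟ᶠ w)) + cover N z)
            ≡⟨ ∑-distrib-+ {n} (λ z → χ (does (z ≟ᶠ w))) (cover N) ⟩
          sum (λ z → χ (does (z ≟ᶠ w))) + sum (cover N)
            ≡⟨ cong₂ _+_ (∑-δ₁ w) (∑-cover N) ⟩
          1 + (size N + size N) ∎) 1+n≰n
          where
          open ≤-Reasoning
          N≤M : size N ≤ size M
          N≤M = ≤-trans (≤k N NS) k≤M
          compare : ∀ z → χ (does (z ≟ᶠ u)) + χ (does (z ≟ᶠ v)) + cover M z ≤ χ (does (z ≟ᶠ w)) + cover N z
          compare z with z ≟ᶠ u | z ≟ᶠ v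
          ... | yes refl | yes u≡v = contradiction u≡v u≢v
          ... | yes refl | no _ rewrite Misses⇒cover≡0 M u Mu =
                  ≤-trans (neighbour-covered NS k≤N Sp wp Nw) (m≤n+m _ _)
          ... | no _ | yes refl rewrite Misses⇒cover≡0 M v Mv =
                  ≤-trans (neighbour-covered NS k≤N Sq wq Nw) (m≤n+m _ _)
          ... | no _ | no _ with z ≟ᶠ w | cover N z in eq
          ...   | yes _  | _     = ≤-trans (cover≤1 MS z) (s≤s z≤n)
          ...   | no _   | suc _ = ≤-trans (cover≤1 MS z) (s≤s z≤n)
          ...   | no z≢w | zero  = ≮⇒≥ λ 1≤ → ¬found (z , z≢w , 1≤ , eq)

      M∩-≤ : ∀ N → size (λ i → M i ∧ N i) ≤ size M
      M∩-≤ N = ∑-mono {m} λ i → χ-mono (proj₁ ∘ ∧-true {M i})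

      go : ∀ fuel {N} → size M ≤ fuel + size (λ i → M i ∧ N i) →
        N MatchingIn S → k ≤ size N → ¬ Misses N w
      improve : ∀ fuel {N} → size M ≤ fuel + size (λ i → M i ∧ N i) → N MatchingIn S → k ≤ size N →
        (∃ λ N′ → N′ MatchingIn S × size N′ ≡ size N × Misses N′ w ×
          size (λ i → M i ∧ N i) < size (λ i → M i ∧ N′ i)) → ⊥

      go fuel {N} bound NS k≤N Nw = improve fuel bound NS k≤N
        (let x , x≢w , M∋x , N∌x = exchange-vertex NS k≤N Nw
             xy , Mxy , x∈xy = covering-edge M x M∋x
             Nx = cover≡0⇒Misses N x N∌x
             yz , Nyz , y∈yz = covering-edge N (other x xy) (neighbour-covered NS k≤N (⊆S MS xy Mxy) x∈xy Nx)
         in exchange MS NS Nw x≢w Mxy x∈xy Nx Nyz y∈yz)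

      -- The fuel bounds how many edges of `M` are absent from `N`. At zero the intersection is all
      -- of `M` and cannot grow.
      improve zero bound NS k≤N (N′ , _ , _ , _ , more) =
        1+n≰n (≤-trans more (≤-trans (M∩-≤ N′) bound))
      improve (suc fuel) bound NS k≤N (N′ , N′S , same , N′w , more) =
        go fuel (≤-trans bound (≤-trans (≤-reflexive (sym (+-suc fuel _))) (+-monoʳ-≤ fuel more)))
          N′S (≤-trans k≤N (≤-reflexive (sym same))) N′w

    -- Sum the degrees in `S`: missed vertices contribute at most `2|M|` by `missed-degrees`,
    -- covered ones at most `Δ` each, and halving gives the claim. The last hypothesis says that no
    -- vertex lies in every maximum matching.
    critical-bound : ∀ {Δ M} → (∀ u → cover S u ≤ Δ) → M MatchingIn S → k ≤ size M →
      (∀ w → ∃ λ N → N MatchingIn S × k ≤ size N × Misses N w) → size S ≤ suc Δ * k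
    critical-bound {Δ} {M} deg≤Δ MS k≤M missable =
      ≤-trans (m+m≤n+n⇒m≤n (begin
        size S + size S
          ≡⟨ ∑-cover S ⟨
        sum (cover S)
          ≤⟨ ∑-mono {n} split ⟩
        sum (λ u → χ (missed u) * cover S u + Δ * cover M u)
          ≡⟨ ∑-distrib-+ {n} (λ u → χ (missed u) * cover S u) (λ u → Δ * cover M u) ⟩
        sum (λ u → χ (missed u) * cover S u) + sum (λ u → Δ * cover M u)
          ≤⟨ +-mono-≤ missed-degrees (≤-reflexive (sym (*-distribˡ-sum Δ (cover M)))) ⟩
        suc Δ * sum (cover M)
          ≡⟨ cong (suc Δ *_) (∑-cover M) ⟩
        suc Δ * (size M + size M)
          ≡⟨ *-distribˡ-+ (suc Δ) (size M) (size M) ⟩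
        suc Δ * size M + suc Δ * size M ∎))
      (*-monoʳ-≤ (suc Δ) (≤k M MS))
      where
      open ≤-Reasoning
      missed : Fin n → Bool
      missed u = does (cover M u ≟ 0)

      missed⇒Misses : ∀ {u} → missed u ≡ true → Misses M u
      missed⇒Misses {u} q = cover≡0⇒Misses M u (does-true (cover M u ≟ 0) q)

      split : ∀ u → cover S u ≤ χ (missed u) * cover S u + Δ * cover M u
      split u with cover M u
      ... | zero  = ≤-trans (≤-reflexive (sym (+-identityʳ (cover S u)))) (m≤m+n _ _)
      ... | suc c = ≤-trans (deg≤Δ u) (m≤m*n Δ (suc c))

      toward : Fin n → Fin m → Bool
      toward w i = inc w i ∧ (S i ∧ missed (other w i))

      -- Two such edges would have distinct far ends, both missed by `M`. As some maximum matching
      -- misses `w`, this contradicts `no-two-missed-neighbours`; `size M` is enough fuel from any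
      -- start.
      toward-unique : ∀ w → sum (χ ∘ toward w) ≤ 1
      toward-unique w = ∑χ-unique (toward w) λ i j p q →
        let wi , p′ = ∧-true {inc w i} p
            wj , q′ = ∧-true {inc w j} q
            Si , mi = ∧-true {S i} p′
            Sj , mj = ∧-true {S j} q′
            N , NS , k≤N , Nw = missable w
        in other-injective {w} {i} {j} (inc⇒Incident wi) (inc⇒Incident wj)
          (decidable-stable (other w i ≟ᶠ other w j) λ differ →
            no-two-missed-neighbours MS k≤M Si Sj (inc⇒Incident wi) (inc⇒Incident wj) refl refl differ
              (missed⇒Misses mi) (missed⇒Misses mj) (size M) (m≤m+n (size M) _) NS k≤N Nw)

      charge : ∀ {u i} → S i ≡ true → Incident u (e i) →
        χ (missed u) ≤ χ (missed u) * cover M (other u i)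
      charge {u} Si ui with missed u in eq
      ... | false = z≤n
      ... | true  = ≤-trans (neighbour-covered MS k≤M Si ui (missed⇒Misses eq)) (m≤m+n _ 0)

      -- A discharging step: the unit of a missed end moves across the edge to the opposite end,
      -- which is covered. The two summands therefore change places.
      per-edge : ∀ i → χ (S i) * χ (missed (src i)) + χ (S i) * χ (missed (tgt i)) ≤
        χ (S i) * (χ (missed (other (src i) i)) * cover M (src i)) +
        χ (S i) * (χ (missed (other (tgt i) i)) * cover M (tgt i))
      per-edge i with S i in Si
      ... | false = z≤n
      ... | true rewrite other-src i | other-tgt i = ≤-trans
        (+-mono-≤ (*-monoʳ-≤ 1 (at (inj₁ refl) (other-src i))) (*-monoʳ-≤ 1 (at (inj₂ refl) (other-tgt i))))
        (≤-reflexive (+-comm (1 * (χ (missed (src i)) * cover M (tgt i))) _))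
        where
        at : ∀ {u v} → Incident u (e i) → other u i ≡ v → χ (missed u) ≤ χ (missed u) * cover M v
        at ui refl = charge Si ui

      per-vertex : ∀ w → sum (λ i → χ (inc w i) * (χ (S i) * (χ (missed (other w i)) * cover M w))) ≤ cover M w
      per-vertex w = begin
        sum (λ i → χ (inc w i) * (χ (S i) * (χ (missed (other w i)) * cover M w)))
          ≡⟨ sum-cong-≗ {m} (λ i → regroup (inc w i) (S i) (missed (other w i)) (cover M w)) ⟩
        sum (λ i → cover M w * χ (toward w i))
          ≡⟨ *-distribˡ-sum (cover M w) (χ ∘ toward w) ⟨
        cover M w * sum (χ ∘ toward w)
          ≤⟨ *-monoʳ-≤ (cover M w) (toward-unique w) ⟩
        cover M w * 1
          ≡⟨ *-identityʳ (cover M w) ⟩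
        cover M w ∎
        where
        regroup : ∀ x y z c → χ x * (χ y * (χ z * c)) ≡ c * χ (x ∧ (y ∧ z))
        regroup false y     z     c = sym (*-zeroʳ c)
        regroup true  false z     c = sym (*-zeroʳ c)
        regroup true  true  false c = sym (*-zeroʳ c)
        regroup true  true  true  c = trans (*-identityˡ _) (trans (*-identityˡ _) (*-comm 1 c))

      -- A missed vertex has only covered neighbours, and a covered vertex has at most one
      -- missed neighbour.
      missed-degrees : sum (λ u → χ (missed u) * cover S u) ≤ sum (cover M)
      missed-degrees = begin
        sum (λ u → χ (missed u) * cover S u)
          ≡⟨ sum-cong-≗ {n} (λ u → trans (*-distribˡ-sum {m} (χ (missed u)) _)
               (sum-cong-≗ {m} λ i → regroup (missed u) (inc u i) (S i))) ⟩
        sum (λ u → sum (λ i → χ (inc u i) * (χ (S i) * χ (missed u))))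
          ≡⟨ handshake (λ i u → χ (S i) * χ (missed u)) ⟩
        sum (λ i → χ (S i) * χ (missed (src i)) + χ (S i) * χ (missed (tgt i)))
          ≤⟨ ∑-mono {m} per-edge ⟩
        sum (λ i → χ (S i) * (χ (missed (other (src i) i)) * cover M (src i)) +
                   χ (S i) * (χ (missed (other (tgt i) i)) * cover M (tgt i)))
          ≡⟨ handshake (λ i w → χ (S i) * (χ (missed (other w i)) * cover M w)) ⟨
        sum (λ w → sum (λ i → χ (inc w i) * (χ (S i) * (χ (missed (other w i)) * cover M w))))
          ≤⟨ ∑-mono {n} per-vertex ⟩
        sum (cover M) ∎
        where
        regroup : ∀ x y z → χ x * χ (y ∧ z) ≡ χ y * (χ z * χ x)
        regroup x y z = trans (*-comm (χ x) _) (trans (cong (_* χ x) (χ-∧ y z)) (*-assoc (χ y) (χ z) (χ x)))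

  -- Vertex deletion, leaving the vertex isolated, and induction on the matching number.

  _⊖_ : (Fin m → Bool) → Fin n → Fin m → Bool
  (S ⊖ w) i = S i ∧ not (inc w i)

  size-⊖ : ∀ S w → size S ≤ cover S w + size (S ⊖ w)
  size-⊖ S w = ≤-trans (∑-mono {m} λ i → split (S i) (inc w i)) (≤-reflexive (∑-distrib-+ {m} _ (χ ∘ (S ⊖ w))))
    where
    split : ∀ s b → χ s ≤ χ (b ∧ s) + χ (s ∧ not b)
    split false _     = z≤n
    split true  true  = ≤-refl
    split true  false = ≤-refl

  cover-⊖ : ∀ S w u → cover (S ⊖ w) u ≤ cover S u
  cover-⊖ S w u = ∑-mono {m} λ i → χ-mono λ q →
    let ui , p = ∧-true {inc u i} q in cong₂ _∧_ ui (proj₁ (∧-true {S i} p))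

  ⊖-MatchingIn : ∀ {N S w} → N MatchingIn (S ⊖ w) → N MatchingIn S
  ⊖-MatchingIn {S = S} NS = record
    { ⊆S = λ i Ni → proj₁ (∧-true {S i} (⊆S NS i Ni)) ; disjoint = disjoint NS }

  ⊖-Misses : ∀ {N S w} → N MatchingIn (S ⊖ w) → Misses N w
  ⊖-Misses {S = S} {w} NS i Ni wi with ∧-true {S i} (⊆S NS i Ni)
  ... | _ , q rewrite Incident⇒inc {w} {i} wi = contradiction q λ ()

  -- Induction on an upper bound `k` for the matching number. If the bound is not attained, lower
  -- it. If some `w` lies in every maximum matching, deleting it lowers the bound and costs at most
  -- `Δ` edges. Otherwise `critical-bound` applies.
  matching-bound : ∀ Δ k S → (∀ u → cover S u ≤ Δ) →
    (∀ N → N MatchingIn S → size N ≤ k) → size S ≤ suc Δ * k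
  -- For `k = 0` the empty matching is maximum and misses every vertex, so this case is already
  -- critical.
  matching-bound Δ zero S deg≤Δ ≤k = critical-bound S zero ≤k {M = ∅} deg≤Δ ∅-matching z≤n
    (λ _ → ∅ , ∅-matching , z≤n , λ _ ())
    where
    ∅ : Fin m → Bool
    ∅ _ = false
    ∅-matching : ∅ MatchingIn S
    ∅-matching = record { ⊆S = λ _ () ; disjoint = λ _ _ _ () }
  matching-bound Δ (suc k) S deg≤Δ ≤k
    with anyMatching? S (suc k ≤?_) | any? (λ w → ¬? (anyMatching? (S ⊖ w) (suc k ≤?_)))
  ... | no none | _ = ≤-trans
        (matching-bound Δ k S deg≤Δ λ N NS → ≤-pred (≰⇒> λ k< → none (N , NS , k<)))
        (*-monoʳ-≤ (suc Δ) (n≤1+n k))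
  ... | yes _ | yes (w , none) = begin
        size S                        ≤⟨ size-⊖ S w ⟩
        cover S w + size (S ⊖ w)      ≤⟨ +-mono-≤ (≤-trans (deg≤Δ w) (n≤1+n Δ))
                                           (matching-bound Δ k (S ⊖ w)
                                             (λ u → ≤-trans (cover-⊖ S w u) (deg≤Δ u))
                                             (λ N NS → ≤-pred (≰⇒> λ k< → none (N , NS , k<)))) ⟩
        suc Δ + suc Δ * k             ≡⟨ *-suc (suc Δ) k ⟨
        suc Δ * suc k                 ∎
        where open ≤-Reasoning
  ... | yes (M , MS , k<M) | no all = critical-bound S (suc k) ≤k deg≤Δ MS k<M λ w →
        let N , NS , k<N = decidable-stable (anyMatching? (S ⊖ w) (suc k ≤?_)) (λ none → all (w , none))
        in N , ⊖-MatchingIn {w = w} NS , k<N , ⊖-Misses NS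

  -- Translation of matchings and the two inequalities.

  IsMatching⇒MatchingIn : ∀ {M} → IsMatching e M → lookup M MatchingIn (λ _ → true)
  IsMatching⇒MatchingIn {M} mat = record
    { ⊆S       = λ _ _ → refl
    ; disjoint = λ u i j Mi Mj ui uj → decidable-stable (i ≟ᶠ j) λ i≢j →
        mat i j (lookup⇒[]= i M Mi) (lookup⇒[]= j M Mj) i≢j u ui uj
    }

  MatchingIn⇒IsMatching : ∀ {N S} → N MatchingIn S → IsMatching e (tabulate N)
  MatchingIn⇒IsMatching {N} NS i j i∈ j∈ i≢j u ui uj = i≢j (disjoint NS u i j (mem i∈) (mem j∈) ui uj)
    where
    mem : ∀ {i} → i ∈ tabulate N → N i ≡ true
    mem {i} i∈ = trans (sym (lookup∘tabulate N i)) ([]=⇒lookup i∈)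

  module _ (α : ℕ) where

    -- An edge of `N` either avoids the heavy set or is charged to a heavy end, and each heavy
    -- vertex is charged at most once.
    matching≤Eα : ArboricityAtMost α e → ∀ {N S} → N MatchingIn S → size N ≤ sizeEα α e
    matching≤Eα arb {N} NS = begin
      size N
        ≤⟨ ∑-mono {m} per-edge ⟩
      sum (λ i → χ (N i) * χ (h (src i)) + χ (N i) * χ (h (tgt i)) + χ (light α i))
        ≡⟨ ∑-distrib-+ {m} _ (χ ∘ light α) ⟩
      sum (λ i → χ (N i) * χ (h (src i)) + χ (N i) * χ (h (tgt i))) + sum (χ ∘ light α)
        ≡⟨ cong (_+ sum (χ ∘ light α)) (handshake (λ i u → χ (N i) * χ (h u))) ⟨
      sum (λ u → sum (λ i → χ (inc u i) * (χ (N i) * χ (h u)))) + sum (χ ∘ light α)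
        ≤⟨ +-monoˡ-≤ _ (∑-mono {n} per-vertex) ⟩
      sum (χ ∘ h) + sum (χ ∘ light α)
        ≤⟨ heavy+light≤Eα α arb ⟩
      sizeEα α e ∎
      where
      open ≤-Reasoning
      h = heavy α

      per-edge : ∀ i → χ (N i) ≤ χ (N i) * χ (h (src i)) + χ (N i) * χ (h (tgt i)) + χ (light α i)
      per-edge i with N i | h (src i) | h (tgt i)
      ... | false | _     | _     = z≤n
      ... | true  | true  | _     = s≤s z≤n
      ... | true  | false | true  = s≤s z≤n
      ... | true  | false | false = s≤s z≤n

      per-vertex : ∀ u → sum (λ i → χ (inc u i) * (χ (N i) * χ (h u))) ≤ χ (h u)
      per-vertex u = begin
        sum (λ i → χ (inc u i) * (χ (N i) * χ (h u)))
          ≡⟨ sum-cong-≗ {m} (λ i → trans (sym (*-assoc (χ (inc u i)) _ _))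
               (trans (cong (_* χ (h u)) (sym (χ-∧ (inc u i) (N i)))) (*-comm _ (χ (h u))))) ⟩
        sum (λ i → χ (h u) * χ (inc u i ∧ N i))
          ≡⟨ *-distribˡ-sum {m} (χ (h u)) _ ⟨
        χ (h u) * cover N u
          ≤⟨ *-monoʳ-≤ (χ (h u)) (cover≤1 NS u) ⟩
        χ (h u) * 1
          ≡⟨ *-identityʳ (χ (h u)) ⟩
        χ (h u) ∎

    inEα : Fin m → Bool
    inEα i = late α (src i) i ∧ late α (tgt i) i

    -- Every edge of E_α at `u` is among the last `α + 1` edges at `u`.
    Eα-degree : ∀ u → cover inEα u ≤ suc α
    Eα-degree u = begin
      cover inEα u                          ≤⟨ ∑-mono {m} weaken ⟩
      sum (λ i → χ (inc u i ∧ late α u i))  ≡⟨ ∑-last α (inc u) ⟩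
      degree u ⊓ suc α                      ≤⟨ m⊓n≤n (degree u) (suc α) ⟩
      suc α                                 ∎
      where
      open ≤-Reasoning
      weaken : ∀ i → χ (inc u i ∧ inEα i) ≤ χ (inc u i ∧ late α u i)
      weaken i = χ-mono λ q →
        let ui , p = ∧-true {inc u i} q
            ls , lt = ∧-true {late α (src i) i} p
        in cong₂ _∧_ ui (at (inc⇒Incident ui) ls lt)
        where
        at : Incident u (e i) → late α (src i) i ≡ true → late α (tgt i) i ≡ true → late α u i ≡ true
        at (inj₁ u≡) ls lt = subst (λ v → late α v i ≡ true) (sym u≡) ls
        at (inj₂ u≡) ls lt = subst (λ v → late α v i ≡ true) (sym u≡) lt

theorem1 : (α n m : ℕ) → 1 ≤ α → (e : Stream n m) → SimpleStream e →
    ArboricityAtMost α e → (M : Subset m) → IsMaximumMatching e M →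
    ∣ M ∣ ≤ sizeEα α e × sizeEα α e ≤ (α + 2) * ∣ M ∣
theorem1 α n m _ e simple arb M (matching , maximum) = lower , upper
  where
  open EdgeStream e simple
  open ≤-Reasoning
  lower : ∣ M ∣ ≤ sizeEα α e
  lower = ≤-trans (≤-reflexive (∣∣≡∑ M))
    (matching≤Eα α arb (IsMatching⇒MatchingIn matching))

  upper : sizeEα α e ≤ (α + 2) * ∣ M ∣
  upper = begin
    sizeEα α e        ≡⟨ sizeEα≡∑ α ⟩
    -- Applied to the subgraph E_α with `Δ = α + 1`, whence the factor `α + 2`; its matchings are
    -- matchings of the whole graph.
    size (inEα α)     ≤⟨ matching-bound (suc α) ∣ M ∣ _ (Eα-degree α) bounded ⟩
    (2 + α) * ∣ M ∣   ≡⟨ cong (_* ∣ M ∣) (+-comm 2 α) ⟩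
    (α + 2) * ∣ M ∣   ∎
    where
    bounded : ∀ N → N MatchingIn inEα α → size N ≤ ∣ M ∣
    bounded N NS = begin
      size N                          ≡⟨ sum-cong-≗ {m} (λ i → cong χ (sym (lookup∘tabulate N i))) ⟩
      sum (χ ∘ lookup (tabulate N))   ≡⟨ ∣∣≡∑ (tabulate N) ⟨
      ∣ tabulate N ∣                  ≤⟨ maximum (tabulate N) (MatchingIn⇒IsMatching NS) ⟩
      ∣ M ∣                           ∎
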